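{- For every $n\ge 3$, the local metric dimension of the convex polytope graph $S_n$ satisfies $lmd(S_n)=2$ if $n$ is odd and $lmd(S_n)=3$ if $n$ is even.
   Context: For $n\ge 3$, $S_n$ is the graph with vertex set $\{a_i,b_i,c_i,d_i : 1\le i\le n\}$ and edge set $\{a_ia_{i+1}, b_ib_{i+1}, c_ic_{i+1}, d_id_{i+1}, a_{i+1}b_i, a_ib_i, b_ic_i, c_id_i : 1\le i\le n\}$, indices taken modulo $n$. $d(u,v)$ is the graph distance. A vertex $w$ resolves $u,v$ if $d(u,w)\neq d(v,w)$. A set $W$ of vertices is a local resolving set if every two adjacent vertices are resolved by some element of $W$; $lmd(G)$ is the minimum cardinality of a local resolving set of $G$. -}

module Defs where

open import Data.Fin.Base using (Fin; toℕ)
open import Data.Fin.Properties using (nonZeroIndex; toℕ<n; toℕ-fromℕ<)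
open import Data.List.Base using (List; length)
open import Data.List.Membership.Propositional using (_∈_)
open import Data.List.Relation.Unary.Unique.Propositional using (Unique)
open import Data.Nat.Base using (ℕ; suc; _≤_; _%_; s≤s)
open import Data.Nat.DivMod using (_mod_; m<n⇒m%n≡m; n%n≡0; m%n<n)
open import Data.Nat.Properties using (m≤n⇒m<n∨m≡n; 1+n≢n)
open import Data.Product.Base using (_×_; _,_; ∃-syntax)
open import Data.Sum.Base using (inj₁; inj₂)
open import Function.Base using (_∘_)
open import Relation.Binary.Construct.Closure.Symmetric as Sym using (SymClosure; fwd; bwd)
open import Relation.Binary.PropositionalEquality using (_≡_; _≢_; refl; sym; trans; cong)

record Graph : Set₁ where
  field
    Vertex     : Set
    Adj        : Vertex → Vertex → Set
    Adj-sym    : ∀ {u v} → Adj u v → Adj v u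
    Adj-irrefl : ∀ {u v} → Adj u v → u ≢ v

IsLeast : (ℕ → Set) → ℕ → Set
IsLeast P k = P k × (∀ j → P j → k ≤ j)

module _ (G : Graph) where
  open Graph G

  data Walk : Vertex → Vertex → ℕ → Set where
    []  : ∀ {u} → Walk u u 0
    _∷_ : ∀ {u v w k} → Adj u v → Walk v w k → Walk u w (suc k)

  -- d(u,v) = k
  Distance : Vertex → Vertex → ℕ → Set
  Distance u v = IsLeast (Walk u v)

  -- d(u,w) ≠ d(v,w).  Both distances are required to exist, so this is
  -- the usual notion on connected graphs only.
  Resolves : Vertex → Vertex → Vertex → Set
  Resolves w u v =
    ∃[ k ] ∃[ l ] (Distance u w k × Distance v w l × k ≢ l)

  -- A finite set of vertices is represented by a duplicate-free list,
  -- whose length is the cardinality of the set.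
  LocalResolving : List Vertex → Set
  LocalResolving W =
    ∀ u v → Adj u v → ∃[ w ] (w ∈ W × Resolves w u v)

  -- lmd(G) = k
  LocalMetricDimension : ℕ → Set
  LocalMetricDimension =
    IsLeast λ m → ∃[ W ] (Unique W × LocalResolving W × length W ≡ m)

private variable
  n : ℕ

-- i + 1 modulo n; the indices 1, …, n are represented by 0, …, n - 1.
next : Fin n → Fin n
next {n} i = _mod_ (suc (toℕ i)) n {{nonZeroIndex i}}

data SVertex (n : ℕ) : Set where
  a b c d : Fin n → SVertex n

data SEdge {n : ℕ} : SVertex n → SVertex n → Set where
  aa  : ∀ i → SEdge (a i) (a (next i))
  bb  : ∀ i → SEdge (b i) (b (next i))
  cc  : ∀ i → SEdge (c i) (c (next i))
  dd  : ∀ i → SEdge (d i) (d (next i))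
  a⁺b : ∀ i → SEdge (a (next i)) (b i)
  ab  : ∀ i → SEdge (a i) (b i)
  bc  : ∀ i → SEdge (b i) (c i)
  cd  : ∀ i → SEdge (c i) (d i)

index : SVertex n → Fin n
index (a i) = i
index (b i) = i
index (c i) = i
index (d i) = i

i≢next[i] : 3 ≤ n → (i : Fin n) → i ≢ next i
i≢next[i] {n@(suc _)} 3≤n i i≡next with m≤n⇒m<n∨m≡n (toℕ<n i)
... | inj₁ 1+i<n = 1+n≢n (sym (trans i≡1+i%n (m<n⇒m%n≡m 1+i<n)))
  where
  i≡1+i%n : toℕ i ≡ suc (toℕ i) % n
  i≡1+i%n = trans (cong toℕ i≡next) (toℕ-fromℕ< (m%n<n (suc (toℕ i)) n))
... | inj₂ 1+i≡n = absurd 3≤n (trans (sym 1+i≡n) (cong suc i≡0))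
  where
  i≡0 : toℕ i ≡ 0
  i≡0 = trans (cong toℕ i≡next)
       (trans (toℕ-fromℕ< (m%n<n (suc (toℕ i)) n))
       (trans (cong (_% n) 1+i≡n) (n%n≡0 n)))
  absurd : ∀ {m} → 3 ≤ m → m ≢ 1
  absurd (s≤s ()) refl

SEdge-irrefl : 3 ≤ n → {u v : SVertex n} → SEdge u v → u ≢ v
SEdge-irrefl 3≤n (aa i)  = i≢next[i] 3≤n i ∘ cong index
SEdge-irrefl 3≤n (bb i)  = i≢next[i] 3≤n i ∘ cong index
SEdge-irrefl 3≤n (cc i)  = i≢next[i] 3≤n i ∘ cong index
SEdge-irrefl 3≤n (dd i)  = i≢next[i] 3≤n i ∘ cong index
SEdge-irrefl 3≤n (a⁺b i) = λ ()
SEdge-irrefl 3≤n (ab i)  = λ ()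
SEdge-irrefl 3≤n (bc i)  = λ ()
SEdge-irrefl 3≤n (cd i)  = λ ()

S : (n : ℕ) → 3 ≤ n → Graph
S n 3≤n = record
  { Vertex     = SVertex n
  ; Adj        = SymClosure SEdge
  ; Adj-sym    = Sym.symmetric SEdge
  ; Adj-irrefl = λ { (fwd e) → SEdge-irrefl 3≤n e
                   ; (bwd e) → SEdge-irrefl 3≤n e ∘ sym }
  }

{-# OPTIONS --safe #-}
module Submission where

-- Place a_i at position 2i and b_i, c_i, d_i at position 2i+1 of ℤ/2n.  The a- and
-- b-vertices form the circulant graph with steps ±1, ±2, so the distance between two
-- vertices is half the circular distance of their positions, rounded up, plus the
-- difference of their levels (0 for a and b, 1 for c, 2 for d).  At position x = 2k or
-- 2k+1 relative to w the first summand is min(s, t) with (s, t) = (k, n-k) or (k+1, n-k),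
-- and moving one position forward increments s or decrements t, alternately.  So, of
-- the edges between consecutive positions, w resolves every other one on each side of it:
-- the edges a_i b_i on one side and the edges b_i a_{i+1} on the other.
-- The vertices a_0 and a_⌈n/2⌉ together resolve all of these.  For even n only antipodal
-- pairs do so, and then both miss the edge of length 2 centred at
-- either; for odd n their exceptional edges of length 2 are different.

open import Defs
open import Data.Fin.Base using (Fin; toℕ)
open import Data.Fin.Properties using (toℕ<n; toℕ-fromℕ<; toℕ-injective)
open import Data.List.Base using (List; []; _∷_; length)
open import Data.List.Membership.Propositional using (_∈_)
open import Data.List.Relation.Unary.All using (All; []; _∷_; lookup)
open import Data.List.Relation.Unary.AllPairs using ([]; _∷_)
open import Data.List.Relation.Unary.Any using (here; there)
open import Data.Nat.Base
open import Data.Nat.Divisibility using (_∣_; _∤_; divides)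
open import Data.Nat.DivMod
open import Data.Nat.Properties
open import Data.Nat.Tactic.RingSolver using (solve-∀)
open import Data.Product.Base using (_×_; _,_; ∃-syntax; swap)
open import Data.Sum.Base using (_⊎_; inj₁; inj₂)
open import Function.Base using (_∘_)
open import Relation.Binary.Construct.Closure.Symmetric using (fwd; bwd)
open import Relation.Binary.Definitions using (tri<; tri≈; tri>)
open import Relation.Binary.PropositionalEquality
open import Relation.Nullary.Decidable using (yes; no)
open import Relation.Nullary.Negation using (¬_; contradiction)

private variable
  A : Set

-- Parity and interleaved sequences.

data Parityᵛ : ℕ → Set where
  even : ∀ k → Parityᵛ (k * 2)
  odd  : ∀ k → Parityᵛ (suc (k * 2))

parityᵛ : ∀ p → Parityᵛ p
parityᵛ zero    = even 0
parityᵛ (suc p) with parityᵛ p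
... | even k = odd k
... | odd k  = even (suc k)

-- The sequence e 0, o 0, e 1, o 1, …
interleave : (ℕ → A) → (ℕ → A) → ℕ → A
interleave e o zero    = e 0
interleave e o (suc p) = interleave o (e ∘ suc) p

interleave-even : ∀ (e o : ℕ → A) k → interleave e o (k * 2) ≡ e k
interleave-even e o zero    = refl
interleave-even e o (suc k) = interleave-even (e ∘ suc) (o ∘ suc) k

interleave-odd : ∀ (e o : ℕ → A) k → interleave e o (suc (k * 2)) ≡ o k
interleave-odd e o = interleave-even o (e ∘ suc)

module _ (_∼_ : A → A → Set) where

  -- Dropping the first term turns `interleave e o` into `interleave o (e ∘ suc)`, so the two
  -- hypotheses trade places at each step and no split on parity is needed.
  interleave-step₁ : ∀ {e o} → (∀ k → e k ∼ o k) → (∀ k → o k ∼ e (suc k)) →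
                     ∀ p → interleave e o p ∼ interleave e o (suc p)
  interleave-step₁ eo oe zero    = eo 0
  interleave-step₁ eo oe (suc p) = interleave-step₁ oe (eo ∘ suc) p

  interleave-step₂ : ∀ {e o} → (∀ k → e k ∼ e (suc k)) → (∀ k → o k ∼ o (suc k)) →
                     ∀ p → interleave e o p ∼ interleave e o (suc (suc p))
  interleave-step₂ ee oo zero    = ee 0
  interleave-step₂ ee oo (suc p) = interleave-step₂ oo (ee ∘ suc) p

-- Periodic sequences and residues modulo `n`.

Periodic : ℕ → (ℕ → A) → Set
Periodic n f = ∀ k → f (k + n) ≡ f k

interleave-periodic : ∀ {n} {e o : ℕ → A} → Periodic n e → Periodic n o →
                      Periodic (n * 2) (interleave e o)
interleave-periodic {n = n} {e} {o} e-per o-per zero    =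
  trans (interleave-even e o n) (e-per 0)
interleave-periodic e-per o-per (suc p) =
  interleave-periodic o-per (e-per ∘ suc) p

periodic-shift : ∀ {n} {f : ℕ → A} → Periodic n f → ∀ s → Periodic n (λ k → f (k + s))
periodic-shift {n = n} {f} per s k = trans (cong f (lemma k n s)) (per (k + s))
  where
  lemma : ∀ k n s → k + n + s ≡ k + s + n
  lemma = solve-∀

periodic-multiple : ∀ {n} {f : ℕ → A} → Periodic n f → ∀ t k → f (k + t * n) ≡ f k
periodic-multiple {f = f} per zero    k = cong f (+-identityʳ k)
periodic-multiple {n = n} {f} per (suc t) k = begin
  f (k + (n + t * n)) ≡⟨ cong f (+-assoc k n (t * n)) ⟨
  f (k + n + t * n)   ≡⟨ periodic-multiple per t (k + n) ⟩
  f (k + n)           ≡⟨ per k ⟩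
  f k                 ∎
  where open ≡-Reasoning

module _ {n : ℕ} .{{_ : NonZero n}} where

  periodic-% : ∀ {f : ℕ → A} → Periodic n f → ∀ k → f (k % n) ≡ f k
  periodic-% {f = f} per k = begin
    f (k % n)               ≡⟨ periodic-multiple per (k / n) (k % n) ⟨
    f (k % n + k / n * n)   ≡⟨ cong f (m≡m%n+[m/n]*n k n) ⟨
    f k                     ∎
    where open ≡-Reasoning

  -- Vertex indices are reduced modulo `n`, positions modulo `n * 2`; along even arguments the
  -- period `n * 2` becomes `n`.
  periodic-%-double : ∀ {f : ℕ → A} → Periodic (n * 2) f → ∀ k → f (k % n * 2) ≡ f (k * 2)
  periodic-%-double {f = f} per =
    periodic-% {f = λ k → f (k * 2)} λ k →
      trans (cong f (*-distribʳ-+ 2 k n)) (per (k * 2))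

  toℕ-mod : ∀ k → toℕ (k mod n) ≡ k % n
  toℕ-mod k = toℕ-fromℕ< (m%n<n k n)

  toℕ%n≡toℕ : (i : Fin n) → toℕ i % n ≡ toℕ i
  toℕ%n≡toℕ i = m<n⇒m%n≡m (toℕ<n i)

  toℕ-mod-inverse : (i : Fin n) → toℕ i mod n ≡ i
  toℕ-mod-inverse i = toℕ-injective (trans (toℕ-mod (toℕ i)) (toℕ%n≡toℕ i))

  mod-periodic : Periodic n (_mod n)
  mod-periodic k = toℕ-injective (begin
    toℕ ((k + n) mod n)   ≡⟨ toℕ-mod (k + n) ⟩
    (k + n) % n           ≡⟨ [m+n]%n≡m%n k n ⟩
    k % n                 ≡⟨ toℕ-mod k ⟨
    toℕ (k mod n)         ∎)
    where open ≡-Reasoning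

  next-mod : ∀ k → next (k mod n) ≡ suc k mod n
  next-mod k = begin
    next (k mod n)              ≡⟨ cong (λ r → suc r mod n) (toℕ-mod k) ⟩
    suc (k % n) mod n           ≡⟨ periodic-% (mod-periodic ∘ suc) k ⟩
    suc k mod n                 ∎
    where open ≡-Reasoning

-- Numbers that differ by at most one, and changes of a minimum.

infix 4 _≈₁_
_≈₁_ : ℕ → ℕ → Set
k ≈₁ l = k ≤ suc l × l ≤ suc k

≈₁-refl : ∀ {k} → k ≈₁ k
≈₁-refl = n≤1+n _ , n≤1+n _

≈₁-suc : ∀ {k} → k ≈₁ suc k
≈₁-suc = m≤n⇒m≤1+n (n≤1+n _) , ≤-refl

≈₁-⊓ : ∀ {k k′ l l′} → k ≈₁ k′ → l ≈₁ l′ → k ⊓ l ≈₁ k′ ⊓ l′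
≈₁-⊓ (p , p′) (q , q′) = ⊓-mono-≤ p q , ⊓-mono-≤ p′ q′

≈₁-+ : ∀ {k l} m → k ≈₁ l → k + m ≈₁ l + m
≈₁-+ m (p , q) = +-monoˡ-≤ m p , +-monoˡ-≤ m q

≈₁-∣-∣ : ∀ k l → ∣ k - l ∣ ≈₁ ∣ suc k - l ∣
≈₁-∣-∣ zero    zero    = ≈₁-suc
≈₁-∣-∣ zero    (suc l) = swap ≈₁-suc
≈₁-∣-∣ (suc k) zero    = ≈₁-suc
≈₁-∣-∣ (suc k) (suc l) = ≈₁-∣-∣ k l

double≢suc-double : ∀ k l → k + k ≢ suc (l + l)
double≢suc-double k l eq = even≢odd k l (trans (2*≡+ k) (trans eq (cong suc (sym (2*≡+ l)))))
  where
  2*≡+ : ∀ k → 2 * k ≡ k + k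
  2*≡+ k = cong (k +_) (+-identityʳ k)

-- The slack of 1 is harmless by parity: `l < k` would give `l + l + 2 ≤ k + k`. It absorbs the
-- rounding in ⌈n/2⌉.
double-cancel-≤ : ∀ {k l} → k + k ≤ suc (l + l) → k ≤ l
double-cancel-≤ {k} {l} 2k≤1+2l = ≮⇒≥ λ l<k →
  <⇒≱ (s≤s (≤-reflexive (sym (+-suc l l)))) (≤-trans (+-mono-≤ l<k l<k) 2k≤1+2l)

double-cancel-≡ : ∀ {k l} → k + k ≡ l + l → k ≡ l
double-cancel-≡ eq = ≤-antisym (double-cancel-≤ (m≤n⇒m≤1+n (≤-reflexive eq)))
                               (double-cancel-≤ (m≤n⇒m≤1+n (≤-reflexive (sym eq))))

⊓-≢ˡ : ∀ {s t} → s < t → s ⊓ t ≢ suc s ⊓ t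
⊓-≢ˡ s<t eq = 1+n≢n (sym (trans (sym (m≤n⇒m⊓n≡m (<⇒≤ s<t))) (trans eq (m≤n⇒m⊓n≡m s<t))))

⊓-≢ʳ : ∀ {s t} → t < s → s ⊓ suc t ≢ s ⊓ t
⊓-≢ʳ t<s eq = 1+n≢n (trans (sym (m≥n⇒m⊓n≡n t<s)) (trans eq (m≥n⇒m⊓n≡n (<⇒≤ t<s))))

-- For `s < t` both minima are the first arguments, for `t < s` the second ones; only at `s = t` do
-- the increment and the decrement cancel.
⊓-≢ : ∀ {s t} → s ≢ t → s ⊓ suc t ≢ suc s ⊓ t
⊓-≢ {s} {t} s≢t eq with <-cmp s t
... | tri< s<t _ _ = 1+n≢n (sym (trans (sym (m≤n⇒m⊓n≡m (m≤n⇒m≤1+n (<⇒≤ s<t)))) (trans eq (m≤n⇒m⊓n≡m s<t))))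
... | tri≈ _ s≡t _ = s≢t s≡t
... | tri> _ _ t<s = 1+n≢n (trans (sym (m≥n⇒m⊓n≡n t<s)) (trans eq (m≥n⇒m⊓n≡n (m≤n⇒m≤1+n (<⇒≤ t<s)))))

+-≢ : ∀ {x y x′ y′ : ℕ} l → x ≡ x′ → y ≡ y′ → x′ ≢ y′ → x + l ≢ y + l
+-≢ l refl refl x≢y eq = x≢y (+-cancelʳ-≡ l _ _ eq)

≡-via : ∀ {x y s t : A} → x ≡ s → y ≡ t → s ≡ t → x ≡ y
≡-via p r eq = trans p (trans eq (sym r))

-- Half the circular distance on ℤ/2n.

module Circle (n : ℕ) .{{_ : NonZero n}} where

  -- With r = `k % n`, position 2k+1 is 2r+1 away from 0 one way round and 2(n-r)-1 the other;
  -- halving and rounding up give r+1 and n-r.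
  gapᵉ gapᵒ : ℕ → ℕ
  gapᵉ k = k % n ⊓ (n ∸ k % n)
  gapᵒ k = suc (k % n) ⊓ (n ∸ k % n)

  -- The distance from 0 to x in the circulant graph on ℤ/2n with steps
  -- ±1 and ±2: half the circular distance, rounded up.
  gap : ℕ → ℕ
  gap = interleave gapᵉ gapᵒ

  gap-even : ∀ k → gap (k * 2) ≡ gapᵉ k
  gap-even = interleave-even gapᵉ gapᵒ

  gap-odd : ∀ k → gap (suc (k * 2)) ≡ gapᵒ k
  gap-odd = interleave-odd gapᵉ gapᵒ

  gapᵉ-periodic : Periodic n gapᵉ
  gapᵉ-periodic k = cong (λ r → r ⊓ (n ∸ r)) ([m+n]%n≡m%n k n)

  gapᵒ-periodic : Periodic n gapᵒ
  gapᵒ-periodic k = cong (λ r → suc r ⊓ (n ∸ r)) ([m+n]%n≡m%n k n)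

  gap-periodic : Periodic (n * 2) gap
  gap-periodic = interleave-periodic gapᵉ-periodic gapᵒ-periodic

  -- At `k = n` the residue is 0 and both sides vanish. This endpoint makes the formula available at
  -- `suc k` for every `k < n`.
  gapᵉ-≤ : ∀ {k} → k ≤ n → gapᵉ k ≡ k ⊓ (n ∸ k)
  gapᵉ-≤ {k} k≤n with m≤n⇒m<n∨m≡n k≤n
  ... | inj₁ k<n  = cong (λ r → r ⊓ (n ∸ r)) (m<n⇒m%n≡m k<n)
  ... | inj₂ refl = begin
    n % n ⊓ (n ∸ n % n)   ≡⟨ cong (λ r → r ⊓ (n ∸ r)) (n%n≡0 n) ⟩
    0                     ≡⟨ ⊓-zeroʳ n ⟨
    n ⊓ 0                 ≡⟨ cong (n ⊓_) (n∸n≡0 n) ⟨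
    n ⊓ (n ∸ n)           ∎
    where open ≡-Reasoning

  gapᵒ-< : ∀ {k} → k < n → gapᵒ k ≡ suc k ⊓ (n ∸ k)
  gapᵒ-< k<n = cong (λ r → suc r ⊓ (n ∸ r)) (m<n⇒m%n≡m k<n)

  gapᵉ[n]≡0 : gapᵉ n ≡ 0
  gapᵉ[n]≡0 = cong (λ r → r ⊓ (n ∸ r)) (n%n≡0 n)

  ∸≡suc : ∀ {r} → r < n → n ∸ r ≡ suc (n ∸ suc r)
  ∸≡suc r<n = +-∸-assoc 1 r<n

  ∸-≈₁ : ∀ {r} → r < n → n ∸ r ≈₁ n ∸ suc r
  ∸-≈₁ {r} r<n = subst (_≈₁ n ∸ suc r) (sym (∸≡suc r<n)) (swap ≈₁-suc)

  gapᵉ-suc : ∀ k → gapᵉ (suc k) ≡ suc (k % n) ⊓ (n ∸ suc (k % n))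
  gapᵉ-suc k = trans (sym (periodic-% (gapᵉ-periodic ∘ suc) k)) (gapᵉ-≤ (m%n<n k n))

  gapᵉ≈gapᵒ : ∀ k → gapᵉ k ≈₁ gapᵒ k
  gapᵉ≈gapᵒ k = ≈₁-⊓ ≈₁-suc ≈₁-refl

  gapᵒ≈gapᵉ : ∀ k → gapᵒ k ≈₁ gapᵉ (suc k)
  gapᵒ≈gapᵉ k rewrite gapᵉ-suc k = ≈₁-⊓ {suc (k % n)} ≈₁-refl (∸-≈₁ (m%n<n k n))

  gapᵉ≈gapᵉ : ∀ k → gapᵉ k ≈₁ gapᵉ (suc k)
  gapᵉ≈gapᵉ k rewrite gapᵉ-suc k = ≈₁-⊓ ≈₁-suc (∸-≈₁ (m%n<n k n))

  gapᵒ[n-1]≡1 : ∀ {k} → suc k ≡ n → gapᵒ k ≡ 1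
  gapᵒ[n-1]≡1 {k} refl = begin
    gapᵒ k                ≡⟨ gapᵒ-< ≤-refl ⟩
    suc k ⊓ (suc k ∸ k)   ≡⟨ cong (suc k ⊓_) (m+n∸n≡m 1 k) ⟩
    suc (k ⊓ 0)           ≡⟨ cong suc (⊓-zeroʳ k) ⟩
    1                     ∎
    where open ≡-Reasoning

  gapᵒ[n]≡1 : gapᵒ n ≡ 1
  gapᵒ[n]≡1 = trans (cong (λ r → suc r ⊓ (n ∸ r)) (n%n≡0 n)) (m≤n⇒m⊓n≡m (>-nonZero⁻¹ n))

  -- The formula of `gapᵒ-<` fails at index `n`, so the step across 0 is separate: positions -1 and
  -- 1 both have value 1.
  gapᵒ≈gapᵒ : ∀ k → gapᵒ k ≈₁ gapᵒ (suc k)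
  gapᵒ≈gapᵒ k = subst₂ _≈₁_ (periodic-% gapᵒ-periodic k)
                            (periodic-% (gapᵒ-periodic ∘ suc) k) (step (m%n<n k n))
    where
    step : ∀ {r} → r < n → gapᵒ r ≈₁ gapᵒ (suc r)
    step {r} r<n with m≤n⇒m<n∨m≡n r<n
    ... | inj₁ 1+r<n rewrite gapᵒ-< r<n | gapᵒ-< 1+r<n =
      ≈₁-⊓ (≈₁-suc {suc r}) (∸-≈₁ r<n)
    ... | inj₂ 1+r≡n rewrite gapᵒ[n-1]≡1 1+r≡n =
      subst (1 ≈₁_) (trans (sym gapᵒ[n]≡1) (cong gapᵒ (sym 1+r≡n))) ≈₁-refl

  gap-step₁ : ∀ p → gap p ≈₁ gap (suc p)
  gap-step₁ = interleave-step₁ _≈₁_ gapᵉ≈gapᵒ gapᵒ≈gapᵉ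

  gap-step₂ : ∀ p → gap p ≈₁ gap (suc (suc p))
  gap-step₂ = interleave-step₂ _≈₁_ gapᵉ≈gapᵉ gapᵒ≈gapᵒ


  -- Where `gap` changes along an edge and where it does not.

  -- In the first half of the circle the first argument attains the minimum, and an even-to-odd step
  -- increments it.
  gapᵉ≢gapᵒ : ∀ {k} → k + k < n → gapᵉ k ≢ gapᵒ k
  gapᵉ≢gapᵒ {k} k+k<n rewrite gapᵉ-≤ (<⇒≤ (m+n≤o⇒m≤o (suc k) k+k<n)) | gapᵒ-< (m+n≤o⇒m≤o (suc k) k+k<n) =
    ⊓-≢ˡ (m+n≤o⇒m≤o∸n (suc k) k+k<n)

  -- In the second half the second argument attains the minimum, and an odd-to-even step decrements
  -- it.
  gapᵒ≢gapᵉ : ∀ {k} → k < n → n ≤ suc (k + k) → gapᵒ k ≢ gapᵉ (suc k)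
  gapᵒ≢gapᵉ {k} k<n n≤1+2k rewrite gapᵒ-< k<n | gapᵉ-≤ k<n | ∸≡suc k<n =
    ⊓-≢ʳ (s≤s (m≤n+o⇒m∸n≤o n (suc k) n≤1+2k))

  -- A step of length 2 moves both arguments in opposite directions, so only the edge centred at the
  -- antipode of 0 has to be excluded.
  gapᵉ≢gapᵉ : ∀ {k} → k < n → suc (k + k) ≢ n → gapᵉ k ≢ gapᵉ (suc k)
  gapᵉ≢gapᵉ {k} k<n 1+2k≢n rewrite gapᵉ-≤ (<⇒≤ k<n) | gapᵉ-≤ k<n | ∸≡suc k<n =
    ⊓-≢ λ k≡n∸1+k → 1+2k≢n (trans (cong (suc k +_) k≡n∸1+k) (m+[n∸m]≡n k<n))

  gapᵒ≢gapᵒ : ∀ {k} → suc k < n → suc k + suc k ≢ n → gapᵒ k ≢ gapᵒ (suc k)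
  gapᵒ≢gapᵒ {k} 1+k<n 2+2k≢n rewrite gapᵒ-< (<⇒≤ 1+k<n) | gapᵒ-< 1+k<n | ∸≡suc (<⇒≤ 1+k<n) =
    ⊓-≢ λ 1+k≡n∸1+k → 2+2k≢n (trans (cong (suc k +_) 1+k≡n∸1+k) (m+[n∸m]≡n (<⇒≤ 1+k<n)))

  -- In the first half the decremented argument is the larger one.
  gapᵒ≡gapᵉ : ∀ {k} → suc k + suc k ≤ n → gapᵒ k ≡ gapᵉ (suc k)
  gapᵒ≡gapᵉ {k} 2+2k≤n rewrite gapᵒ-< (m+n≤o⇒m≤o (suc k) 2+2k≤n) | gapᵉ-≤ (m+n≤o⇒m≤o (suc k) 2+2k≤n)
                             | ∸≡suc (m+n≤o⇒m≤o (suc k) 2+2k≤n) =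
    trans (m≤n⇒m⊓n≡m (m≤n⇒m≤1+n 1+k≤n∸1+k)) (sym (m≤n⇒m⊓n≡m 1+k≤n∸1+k))
    where
    1+k≤n∸1+k : suc k ≤ n ∸ suc k
    1+k≤n∸1+k = m+n≤o⇒m≤o∸n (suc k) 2+2k≤n

  gapᵉ≡gapᵒ : ∀ {k} → k < n → n ≤ k + k → gapᵉ k ≡ gapᵒ k
  gapᵉ≡gapᵒ {k} k<n n≤2k rewrite gapᵉ-≤ (<⇒≤ k<n) | gapᵒ-< k<n =
    trans (m≥n⇒m⊓n≡n n∸k≤k) (sym (m≥n⇒m⊓n≡n (m≤n⇒m≤1+n n∸k≤k)))
    where
    n∸k≤k : n ∸ k ≤ k
    n∸k≤k = m≤n+o⇒m∸n≤o n k n≤2k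

-- Walks of bounded length and distances.

module Reachability (G : Graph) where
  open Graph G

  -- A bound rather than an exact length, so that a step which stays at the same vertex may still
  -- count as 1.
  Reach : Vertex → Vertex → ℕ → Set
  Reach u v k = ∃[ j ] (j ≤ k × Walk G u v j)

  _++ʷ_ : ∀ {u v w k l} → Walk G u v k → Walk G v w l → Walk G u w (k + l)
  []      ++ʷ q = q
  (e ∷ p) ++ʷ q = e ∷ (p ++ʷ q)

  reverseʷ : ∀ {u v k} → Walk G u v k → Walk G v u k
  reverseʷ [] = []
  reverseʷ {u} {v} {suc k} (e ∷ p) =
    subst (Walk G v u) (+-comm k 1) (reverseʷ p ++ʷ (Adj-sym e ∷ []))

  reach-refl : ∀ {u k} → Reach u u k
  reach-refl = 0 , z≤n , []

  reach-adj : ∀ {u v} → Adj u v → Reach u v 1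
  reach-adj e = 1 , ≤-refl , e ∷ []

  reach-sym : ∀ {u v k} → Reach u v k → Reach v u k
  reach-sym (j , j≤k , p) = j , j≤k , reverseʷ p

  reach-trans : ∀ {u v w k l} → Reach u v k → Reach v w l → Reach u w (k + l)
  reach-trans (j , j≤k , p) (i , i≤l , q) = j + i , +-mono-≤ j≤k i≤l , p ++ʷ q

  reach-⊓ : ∀ {u v} k l → Reach u v k → Reach u v l → Reach u v (k ⊓ l)
  reach-⊓ {u} {v} k l p q with ≤-total k l
  ... | inj₁ k≤l = subst (Reach u v) (sym (m≤n⇒m⊓n≡m k≤l)) p
  ... | inj₂ l≤k = subst (Reach u v) (sym (m≥n⇒m⊓n≡n l≤k)) q

  reach-initial : (f : ℕ → Vertex) → (∀ k → Reach (f k) (f (suc k)) 1) →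
                  ∀ l → Reach (f 0) (f l) l
  reach-initial f step zero    = reach-refl
  reach-initial f step (suc l) = reach-trans (step 0) (reach-initial (f ∘ suc) (step ∘ suc) l)

  reach-sequence : (f : ℕ → Vertex) → (∀ k → Reach (f k) (f (suc k)) 1) →
                   ∀ k l → Reach (f k) (f l) ∣ k - l ∣
  reach-sequence f step zero    l       = reach-initial f step l
  reach-sequence f step (suc k) zero    = reach-sym (reach-initial f step (suc k))
  reach-sequence f step (suc k) (suc l) = reach-sequence (f ∘ suc) (step ∘ suc) k l

  reach-even : (f : ℕ → Vertex) → (∀ p → Reach (f p) (f (suc (suc p))) 1) →
               ∀ p k → Reach (f p) (f (k * 2 + p)) k
  reach-even f step p = reach-initial (λ j → f (j * 2 + p)) (λ j → step (j * 2 + p))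

  distance-unique : ∀ {u v k l} → Distance G u v k → Distance G u v l → k ≡ l
  distance-unique (p , k-least) (q , l-least) = ≤-antisym (k-least _ q) (l-least _ p)

  -- `φ` drops by at most 1 per edge and ends at 0, so it bounds the length of every walk to `w`
  -- from below; the walk given by `reach` must then have length exactly `φ u`.
  potential⇒distance : ∀ {w} (φ : Vertex → ℕ) → φ w ≡ 0 →
                       (∀ {u v} → Adj u v → φ u ≤ suc (φ v)) →
                       (∀ u → Reach u w (φ u)) →
                       ∀ u → Distance G u w (φ u)
  potential⇒distance {w} φ φw≡0 lipschitz reach u with reach u
  ... | j , j≤φu , p =
    subst (Walk G u w) (≤-antisym j≤φu (bound p)) p , λ _ → bound
    where
    bound : ∀ {v k} → Walk G v w k → φ v ≤ k
    bound []      = ≤-reflexive φw≡0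
    bound (e ∷ q) = ≤-trans (lipschitz e) (s≤s (bound q))

-- The distance function of the polytope graph.

module Polytope (n : ℕ) (3≤n : 3 ≤ n) where

  private
    G : Graph
    G = S n 3≤n

    instance
      n≢0 : NonZero n
      n≢0 = >-nonZero (<-trans z<s 3≤n)

  open Graph G
  open Circle n
  open Reachability G

  position : Vertex → ℕ
  position (a i) = toℕ i * 2
  position (b i) = suc (toℕ i * 2)
  position (c i) = suc (toℕ i * 2)
  position (d i) = suc (toℕ i * 2)

  level : Vertex → ℕ
  level (a i) = 0
  level (b i) = 0
  level (c i) = 1
  level (d i) = 2

  aₖ bₖ cₖ dₖ : ℕ → Vertex
  aₖ k = a (k mod n)
  bₖ k = b (k mod n)
  cₖ k = c (k mod n)
  dₖ k = d (k mod n)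

  -- In rows c and d the positions 2k and 2k+1 denote the same vertex.
  row : ℕ → ℕ → Vertex
  row 0             = interleave aₖ bₖ
  row 1             = interleave cₖ cₖ
  row (suc (suc _)) = interleave dₖ dₖ

  rim : ℕ → Vertex
  rim = row 0

  row-periodic : ∀ l → Periodic (n * 2) (row l)
  row-periodic 0             = interleave-periodic {e = aₖ} {bₖ} (cong a ∘ mod-periodic) (cong b ∘ mod-periodic)
  row-periodic 1             = interleave-periodic {e = cₖ} {cₖ} (cong c ∘ mod-periodic) (cong c ∘ mod-periodic)
  row-periodic (suc (suc _)) = interleave-periodic {e = dₖ} {dₖ} (cong d ∘ mod-periodic) (cong d ∘ mod-periodic)

  row-level-position : ∀ u → row (level u) (position u) ≡ u
  row-level-position (a i) = trans (interleave-even aₖ bₖ (toℕ i)) (cong a (toℕ-mod-inverse i))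
  row-level-position (b i) = trans (interleave-odd aₖ bₖ (toℕ i)) (cong b (toℕ-mod-inverse i))
  row-level-position (c i) = trans (interleave-odd cₖ cₖ (toℕ i)) (cong c (toℕ-mod-inverse i))
  row-level-position (d i) = trans (interleave-odd dₖ dₖ (toℕ i)) (cong d (toℕ-mod-inverse i))

  a-step : ∀ k → Adj (aₖ k) (aₖ (suc k))
  a-step k = subst (Adj (aₖ k) ∘ a) (next-mod k) (fwd (aa (k mod n)))

  b-step : ∀ k → Adj (bₖ k) (bₖ (suc k))
  b-step k = subst (Adj (bₖ k) ∘ b) (next-mod k) (fwd (bb (k mod n)))

  c-step : ∀ k → Adj (cₖ k) (cₖ (suc k))
  c-step k = subst (Adj (cₖ k) ∘ c) (next-mod k) (fwd (cc (k mod n)))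

  d-step : ∀ k → Adj (dₖ k) (dₖ (suc k))
  d-step k = subst (Adj (dₖ k) ∘ d) (next-mod k) (fwd (dd (k mod n)))

  rim-step₁ : ∀ p → Adj (rim p) (rim (suc p))
  rim-step₁ = interleave-step₁ Adj {aₖ} {bₖ} (λ k → fwd (ab (k mod n)))
    (λ k → subst (Adj (bₖ k) ∘ a) (next-mod k) (bwd (a⁺b (k mod n))))

  rim-step₂ : ∀ p → Adj (rim p) (rim (suc (suc p)))
  rim-step₂ = interleave-step₂ Adj {aₖ} {bₖ} a-step b-step

  row-step₁ : ∀ l p → Reach (row l p) (row l (suc p)) 1
  row-step₁ 0             = reach-adj ∘ rim-step₁
  row-step₁ 1             = interleave-step₁ (λ u v → Reach u v 1) {cₖ} {cₖ} (λ _ → reach-refl) (reach-adj ∘ c-step)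
  row-step₁ (suc (suc _)) = interleave-step₁ (λ u v → Reach u v 1) {dₖ} {dₖ} (λ _ → reach-refl) (reach-adj ∘ d-step)

  row-step₂ : ∀ l p → Reach (row l p) (row l (suc (suc p))) 1
  row-step₂ 0             = reach-adj ∘ rim-step₂
  row-step₂ 1             = reach-adj ∘ interleave-step₂ Adj {cₖ} {cₖ} c-step c-step
  row-step₂ (suc (suc _)) = reach-adj ∘ interleave-step₂ Adj {dₖ} {dₖ} d-step d-step

  -- Only odd positions carry vertical edges: at position 2k row 0 holds an a-vertex, which has no
  -- neighbour in row c.
  column : ∀ k l l′ → Reach (row l (suc (k * 2))) (row l′ (suc (k * 2))) ∣ l - l′ ∣
  column k = reach-sequence (λ l → row l (suc (k * 2))) step
    where
    step : ∀ l → Reach (row l (suc (k * 2))) (row (suc l) (suc (k * 2))) 1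
    step 0             = subst₂ (λ u v → Reach u v 1)
      (sym (interleave-odd aₖ bₖ k)) (sym (interleave-odd cₖ cₖ k)) (reach-adj (fwd (bc (k mod n))))
    step 1             = subst₂ (λ u v → Reach u v 1)
      (sym (interleave-odd cₖ cₖ k)) (sym (interleave-odd dₖ dₖ k)) (reach-adj (fwd (cd (k mod n))))
    step (suc (suc _)) = reach-refl

  -- The two arguments of the minimum in `gap` are the lengths of the two ways around the row, taken
  -- in steps of 2 with one step of 1 when `x` is odd.
  row-reach : ∀ l q x → Reach (row l (x + q)) (row l q) (gap x)
  row-reach l q x with parityᵛ x
  ... | even k = subst₂ (λ u → Reach u (row l q))
                   (periodic-%-double (periodic-shift (row-periodic l) q) k) (sym (gap-even k))
                   (reach-⊓ r (n ∸ r) backward forward)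
    where
    r = k % n

    backward : Reach (row l (r * 2 + q)) (row l q) r
    backward = reach-sym (reach-even (row l) (row-step₂ l) q r)

    around : ∀ t r q → t * 2 + (r * 2 + q) ≡ q + (t + r) * 2
    around = solve-∀

    forward : Reach (row l (r * 2 + q)) (row l q) (n ∸ r)
    forward = subst (λ v → Reach (row l (r * 2 + q)) v (n ∸ r))
      (begin
        row l ((n ∸ r) * 2 + (r * 2 + q))  ≡⟨ cong (row l) (around (n ∸ r) r q) ⟩
        row l (q + (n ∸ r + r) * 2)        ≡⟨ cong (λ m → row l (q + m * 2)) (m∸n+n≡m (<⇒≤ (m%n<n k n))) ⟩
        row l (q + n * 2)                  ≡⟨ row-periodic l q ⟩
        row l q                            ∎)
      (reach-even (row l) (row-step₂ l) (r * 2 + q) (n ∸ r))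
      where open ≡-Reasoning
  ... | odd k  = subst₂ (λ u → Reach u (row l q))
                   (periodic-%-double (periodic-shift (row-periodic l ∘ suc) q) k) (sym (gap-odd k))
                   (reach-⊓ (suc r) (n ∸ r) backward forward)
    where
    r = k % n
    -- Going on around from an odd position takes `t` steps of length 2 and a last one of length 1,
    -- in total `n ∸ r`.
    t = n ∸ suc r

    backward : Reach (row l (suc (r * 2 + q))) (row l q) (suc r)
    backward = reach-sym (reach-trans (row-step₁ l q)
      (subst (λ p → Reach (row l (suc q)) (row l p) r) (+-suc (r * 2) q)
        (reach-even (row l) (row-step₂ l) (suc q) r)))

    around : ∀ t r q → suc (t * 2 + suc (r * 2 + q)) ≡ q + (t + suc r) * 2
    around = solve-∀

    forward : Reach (row l (suc (r * 2 + q))) (row l q) (n ∸ r)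
    forward = subst₂ (Reach (row l (suc (r * 2 + q))))
      (begin
        row l (suc (t * 2 + suc (r * 2 + q)))  ≡⟨ cong (row l) (around t r q) ⟩
        row l (q + (t + suc r) * 2)            ≡⟨ cong (λ m → row l (q + m * 2)) (m∸n+n≡m (m%n<n k n)) ⟩
        row l (q + n * 2)                      ≡⟨ row-periodic l q ⟩
        row l q                                ∎)
      (trans (+-comm t 1) (sym (∸≡suc (m%n<n k n))))
      (reach-trans (reach-even (row l) (row-step₂ l) (suc (r * 2 + q)) t)
                   (row-step₁ l (t * 2 + suc (r * 2 + q))))
      where open ≡-Reasoning

  odd-position-≤ : (i : Fin n) → suc (toℕ i * 2) ≤ n * 2
  odd-position-≤ i = <⇒≤ (*-monoˡ-≤ 2 (toℕ<n i))

  position-≤ : ∀ u → position u ≤ n * 2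
  position-≤ (a i) = <⇒≤ (odd-position-≤ i)
  position-≤ (b i) = odd-position-≤ i
  position-≤ (c i) = odd-position-≤ i
  position-≤ (d i) = odd-position-≤ i

  -- Adding `n * 2 ∸ position w` stands for subtracting `position w` modulo the period of `gap`,
  -- without truncation.
  dist : Vertex → Vertex → ℕ
  dist w u = gap (position u + (n * 2 ∸ position w)) + ∣ level u - level w ∣

  row-reach-position : ∀ l p w →
    Reach (row l p) (row l (position w)) (gap (p + (n * 2 ∸ position w)))
  row-reach-position l p w =
    subst (λ u → Reach u (row l q) (gap (p + (n * 2 ∸ q))))
      (begin
        row l (p + (n * 2 ∸ q) + q)    ≡⟨ cong (row l) (+-assoc p _ q) ⟩
        row l (p + (n * 2 ∸ q + q))    ≡⟨ cong (λ m → row l (p + m)) (m∸n+n≡m (position-≤ w)) ⟩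
        row l (p + n * 2)              ≡⟨ row-periodic l p ⟩
        row l p                        ∎)
      (row-reach l q (p + (n * 2 ∸ q)))
    where
    open ≡-Reasoning
    q = position w

  -- Rows c and d have no vertices in even positions, so a walk from an a-vertex
  -- changes level at its end, any other walk at its beginning.
  reach-dist : ∀ w u → Reach u w (dist w u)
  reach-dist w u = subst₂ (λ u′ w′ → Reach u′ w′ (dist w u))
    (row-level-position u) (row-level-position w) (go u)
    where
    climb : ∀ w → Reach (row 0 (position w)) (row (level w) (position w)) (level w)
    climb (a i) = reach-refl
    climb (b i) = column (toℕ i) 0 0
    climb (c i) = column (toℕ i) 0 1
    climb (d i) = column (toℕ i) 0 2

    columnFirst : ∀ k l → Reach (row l (suc (k * 2))) (row (level w) (position w))
      (gap (suc (k * 2) + (n * 2 ∸ position w)) + ∣ l - level w ∣)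
    columnFirst k l = subst (Reach _ _) (+-comm ∣ l - level w ∣ _)
      (reach-trans (column k l (level w)) (row-reach-position (level w) (suc (k * 2)) w))

    go : ∀ u → Reach (row (level u) (position u)) (row (level w) (position w)) (dist w u)
    go (a i) = reach-trans (row-reach-position 0 (toℕ i * 2) w) (climb w)
    go (b i) = columnFirst (toℕ i) 0
    go (c i) = columnFirst (toℕ i) 1
    go (d i) = columnFirst (toℕ i) 2

  dist-self : ∀ w → dist w w ≡ 0
  dist-self w = cong₂ _+_
    (trans (cong gap (m+[n∸m]≡n (position-≤ w))) (trans (gap-even n) gapᵉ[n]≡0))
    (∣n-n∣≡0 (level w))

  -- This takes care of the edges that wrap around, where `next` returns to index 0 but the position
  -- keeps growing.
  gap-mod : ∀ k s → gap (toℕ (k mod n) * 2 + s) ≡ gap (k * 2 + s)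
  gap-mod k s = trans (cong (λ r → gap (r * 2 + s)) (toℕ-mod k))
    (periodic-%-double (periodic-shift gap-periodic s) k)

  gap-mod-suc : ∀ k s → gap (suc (toℕ (k mod n) * 2) + s) ≡ gap (suc (k * 2) + s)
  gap-mod-suc k s = trans (cong (λ r → gap (suc (r * 2) + s)) (toℕ-mod k))
    (periodic-%-double (periodic-shift (gap-periodic ∘ suc) s) k)

  dist-edge : ∀ w {u v} → SEdge u v → dist w u ≈₁ dist w v
  dist-edge w e = go e
    where
    s = n * 2 ∸ position w

    odd-edge : ∀ (i : Fin n) l → gap (suc (toℕ i * 2) + s) + l ≈₁ gap (suc (toℕ (next i) * 2) + s) + l
    odd-edge i l = ≈₁-+ l (subst (gap (suc (toℕ i * 2) + s) ≈₁_) (sym (gap-mod-suc (suc (toℕ i)) s))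
      (gap-step₂ (suc (toℕ i * 2) + s)))

    level-edge : ∀ x {l l′} → l ≈₁ l′ → x + l ≈₁ x + l′
    level-edge x {l} {l′} p rewrite +-comm x l | +-comm x l′ = ≈₁-+ x p

    go : ∀ {u v} → SEdge u v → dist w u ≈₁ dist w v
    go (aa i) rewrite gap-mod (suc (toℕ i)) s = ≈₁-+ _ (gap-step₂ (toℕ i * 2 + s))
    go (bb i) = odd-edge i _
    go (cc i) = odd-edge i _
    go (dd i) = odd-edge i _
    go (a⁺b i) rewrite gap-mod (suc (toℕ i)) s = ≈₁-+ _ (swap (gap-step₁ (suc (toℕ i * 2) + s)))
    go (ab i) = ≈₁-+ _ (gap-step₁ (toℕ i * 2 + s))
    go (bc i) = level-edge _ (≈₁-∣-∣ 0 (level w))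
    go (cd i) = level-edge _ (≈₁-∣-∣ 1 (level w))

  dist-adj : ∀ w {u v} → Adj u v → dist w u ≤ suc (dist w v)
  dist-adj w (fwd e) = let p , _ = dist-edge w e in p
  dist-adj w (bwd e) = let _ , q = dist-edge w e in q

  distance : ∀ w u → Distance G u w (dist w u)
  distance w = potential⇒distance (dist w) (dist-self w) (dist-adj w) (reach-dist w)

  resolves : ∀ {w u v} → dist w u ≢ dist w v → Resolves G w u v
  resolves {w} {u} {v} ≢ = _ , _ , distance w u , distance w v , ≢

  resolves⁻¹ : ∀ {w u v} → Resolves G w u v → dist w u ≢ dist w v
  resolves⁻¹ {w} {u} {v} (k , l , p , q , k≢l) eq = k≢l (begin
    k          ≡⟨ distance-unique p (distance w u) ⟩
    dist w u   ≡⟨ eq ⟩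
    dist w v   ≡⟨ distance-unique q (distance w v) ⟨
    l          ∎)
    where open ≡-Reasoning

  dist-rim : ∀ w p → dist w (rim p) ≡ gap (p + (n * 2 ∸ position w)) + level w
  dist-rim w p with parityᵛ p
  ... | even k rewrite interleave-even aₖ bₖ k =
    cong (_+ level w) (gap-mod k (n * 2 ∸ position w))
  ... | odd k rewrite interleave-odd aₖ bₖ k =
    cong (_+ level w) (gap-mod-suc k (n * 2 ∸ position w))

  -- Lower bounds: edges that small sets fail to resolve.

  Unresolved : List Vertex → Set
  Unresolved W = ∃[ u ] ∃[ v ] (Adj u v × All (λ w → dist w u ≡ dist w v) W)

  unresolved⇒¬resolving : ∀ {W} → Unresolved W → ¬ LocalResolving G W
  unresolved⇒¬resolving (u , v , e , all≡) resolving with resolving u v e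
  ... | w , w∈W , r = resolves⁻¹ r (lookup all≡ w∈W)

  gap-self : ∀ w z → gap (z + position w + (n * 2 ∸ position w)) ≡ gap z
  gap-self w z = begin
    gap (z + q + (n * 2 ∸ q))     ≡⟨ cong gap (+-assoc z q _) ⟩
    gap (z + (q + (n * 2 ∸ q)))   ≡⟨ cong (λ x → gap (z + x)) (m+[n∸m]≡n (position-≤ w)) ⟩
    gap (z + n * 2)               ≡⟨ gap-periodic z ⟩
    gap z                         ∎
    where
    open ≡-Reasoning
    q = position w

  rim-≡ : ∀ w p p′ → gap (p + (n * 2 ∸ position w)) ≡ gap (p′ + (n * 2 ∸ position w)) →
          dist w (rim p) ≡ dist w (rim p′)
  rim-≡ w p p′ eq = trans (dist-rim w p) (trans (cong (_+ level w) eq) (sym (dist-rim w p′)))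

  rim-≡-self : ∀ w {z z′} → gap z ≡ gap z′ →
               dist w (rim (z + position w)) ≡ dist w (rim (z′ + position w))
  rim-≡-self w {z} {z′} eq = rim-≡ w (z + position w) (z′ + position w)
    (trans (gap-self w z) (trans eq (sym (gap-self w z′))))

  gapᵒ[0]≡gapᵉ[1] : gapᵒ 0 ≡ gapᵉ 1
  gapᵒ[0]≡gapᵉ[1] = gapᵒ≡gapᵉ (≤-trans (n≤1+n 2) 3≤n)

  unresolved-[] : Unresolved []
  unresolved-[] = _ , _ , rim-step₁ 0 , []

  -- Positions 1 and 2 past `w` both have `gap` 1 from it.
  unresolved-singleton : ∀ w → Unresolved (w ∷ [])
  unresolved-singleton w =
    _ , _ , rim-step₁ (1 + position w) , rim-≡-self w {1} {2} gapᵒ[0]≡gapᵉ[1] ∷ []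

  -- Of the four edges with positions (1, 2), (n-1, n), (n, n+1) and (-1, 1)
  -- relative to w, none is resolved by w and one is not resolved by w′.
  unresolved-ordered : ∀ m → m + m ≡ n → ∀ w w′ → position w ≤ position w′ → Unresolved (w ∷ w′ ∷ [])
  unresolved-ordered zero    0≡n = contradiction (≤-trans 3≤n (≤-reflexive (sym 0≡n))) λ ()
  unresolved-ordered (suc m′) m+m≡n w w′ q≤q′ = cases (parityᵛ g) refl
    where
    m q q′ g : ℕ
    m = suc m′
    q = position w
    q′ = position w′
    -- The position of `w` relative to `w′`, so that `z + g` is relative to `w′` what `z` is
    -- relative to `w`.
    g = q + (n * 2 ∸ q′)

    g≤2n : g ≤ n * 2
    g≤2n = ≤-trans (+-monoˡ-≤ _ q≤q′) (≤-reflexive (m+[n∸m]≡n (position-≤ w′)))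

    rim-≡′ : ∀ {z z′} → gap (z + g) ≡ gap (z′ + g) → dist w′ (rim (z + q)) ≡ dist w′ (rim (z′ + q))
    rim-≡′ {z} {z′} eq = rim-≡ w′ (z + q) (z′ + q)
      (trans (cong gap (+-assoc z q _)) (trans eq (cong gap (sym (+-assoc z′ q _)))))

    edge₁ : ∀ z → gap z ≡ gap (suc z) → gap (z + g) ≡ gap (suc z + g) → Unresolved (w ∷ w′ ∷ [])
    edge₁ z eq eq′ = _ , _ , rim-step₁ (z + q) , rim-≡-self w {z} {suc z} eq ∷ rim-≡′ {z} {suc z} eq′ ∷ []

    edge₂ : ∀ z → gap z ≡ gap (suc (suc z)) → gap (z + g) ≡ gap (suc (suc z) + g) → Unresolved (w ∷ w′ ∷ [])
    edge₂ z eq eq′ = _ , _ , rim-step₂ (z + q) , rim-≡-self w {z} {suc (suc z)} eq ∷ rim-≡′ {z} {suc (suc z)} eq′ ∷ []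

    even+even : ∀ k f → gap (k * 2 + f * 2) ≡ gapᵉ (k + f)
    even+even k f = trans (cong gap (sym (*-distribʳ-+ 2 k f))) (gap-even (k + f))

    odd+even : ∀ k f → gap (suc (k * 2) + f * 2) ≡ gapᵒ (k + f)
    odd+even k f = trans (cong (gap ∘ suc) (sym (*-distribʳ-+ 2 k f))) (gap-odd (k + f))

    even+odd : ∀ k f → gap (k * 2 + suc (f * 2)) ≡ gapᵒ (k + f)
    even+odd k f = trans (cong gap (+-suc (k * 2) (f * 2))) (odd+even k f)

    odd+odd : ∀ k f → gap (suc (k * 2) + suc (f * 2)) ≡ gapᵉ (suc (k + f))
    odd+odd k f = trans (cong (gap ∘ suc) (+-suc (k * 2) (f * 2))) (even+even (suc k) f)

    m<n : m < n
    m<n = ≤-trans (m<m+n m z<s) (≤-reflexive m+m≡n)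

    gapᵒ[m′]≡gapᵉ[m] : gapᵒ m′ ≡ gapᵉ m
    gapᵒ[m′]≡gapᵉ[m] = gapᵒ≡gapᵉ (≤-reflexive m+m≡n)

    gapᵉ[m]≡gapᵒ[m] : gapᵉ m ≡ gapᵒ m
    gapᵉ[m]≡gapᵒ[m] = gapᵉ≡gapᵒ m<n (≤-reflexive (sym m+m≡n))

    evenCase : ∀ f → g ≡ f * 2 → Unresolved (w ∷ w′ ∷ [])
    evenCase f g≡2f with <-cmp f m
    -- Relative to `w′` the edge (1, 2) starts at the odd position 2f+1 and stays in the first half.
    ... | tri< f<m _ _ = edge₁ 1 gapᵒ[0]≡gapᵉ[1]
      (subst (λ g → gap (1 + g) ≡ gap (2 + g)) (sym g≡2f)
        (≡-via (odd+even 0 f) (even+even 1 f)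
          (gapᵒ≡gapᵉ (≤-trans (+-mono-≤ f<m f<m) (≤-reflexive m+m≡n)))))
    -- Antipodal positions, `g` being `n`: the edge (-1, 1), written as (2n-1, 2n+1), is centred at
    -- `w` and opposite to `w′`.
    ... | tri≈ _ refl _ = edge₂ (suc ((m′ + m) * 2))
      (≡-via (gap-odd (m′ + m)) (gap-odd (suc (m′ + m)))
        (trans (gapᵒ[n-1]≡1 m+m≡n) (trans (sym gapᵒ[n]≡1) (cong gapᵒ (sym m+m≡n)))))
      (subst (λ g → gap (suc ((m′ + m) * 2) + g) ≡ gap (suc (suc (m′ + m) * 2) + g)) (sym g≡2f)
        (≡-via (odd+even (m′ + m) m) (odd+even (suc (m′ + m)) m) (begin
          gapᵒ (m′ + m + m)         ≡⟨ cong gapᵒ (+-assoc m′ m m) ⟩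
          gapᵒ (m′ + (m + m))       ≡⟨ cong (λ x → gapᵒ (m′ + x)) m+m≡n ⟩
          gapᵒ (m′ + n)             ≡⟨ gapᵒ-periodic m′ ⟩
          gapᵒ m′                   ≡⟨ gapᵒ[m′]≡gapᵉ[m] ⟩
          gapᵉ m                    ≡⟨ gapᵉ[m]≡gapᵒ[m] ⟩
          gapᵒ m                    ≡⟨ gapᵒ-periodic m ⟨
          gapᵒ (m + n)              ≡⟨ cong (λ x → gapᵒ (m + x)) m+m≡n ⟨
          gapᵒ (m + (m + m))        ≡⟨ cong gapᵒ (+-assoc m m m) ⟨
          gapᵒ (suc (m′ + m) + m)   ∎)))
      where open ≡-Reasoning
    -- The edge (n-1, n) lies at (2j+1, 2j+2) from `w′` modulo 2n, where f = m+1+j; `f ≤ n` gives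
    -- `j < m` and keeps it in the first half.
    ... | tri> _ _ m<f with m≤n⇒∃[o]m+o≡n m<f
    ...   | j , refl = edge₁ (suc (m′ * 2))
      (≡-via (gap-odd m′) (gap-even m) gapᵒ[m′]≡gapᵉ[m])
      (subst (λ g → gap (suc (m′ * 2) + g) ≡ gap (m * 2 + g)) (sym g≡2f)
        (≡-via (odd+even m′ f) (even+even m f) (begin
          gapᵒ (m′ + f)        ≡⟨ cong gapᵒ m′+f≡j+n ⟩
          gapᵒ (j + n)         ≡⟨ gapᵒ-periodic j ⟩
          gapᵒ j               ≡⟨ gapᵒ≡gapᵉ (≤-trans (+-mono-≤ j<m j<m) (≤-reflexive m+m≡n)) ⟩
          gapᵉ (suc j)         ≡⟨ gapᵉ-periodic (suc j) ⟨
          gapᵉ (suc (j + n))   ≡⟨ cong (gapᵉ ∘ suc) m′+f≡j+n ⟨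
          gapᵉ (m + f)         ∎)))
      where
      open ≡-Reasoning
      lemma : ∀ m′ j → m′ + suc (suc m′ + j) ≡ j + (suc m′ + suc m′)
      lemma = solve-∀

      m′+f≡j+n : m′ + f ≡ j + n
      m′+f≡j+n = trans (lemma m′ j) (cong (j +_) m+m≡n)

      j<m : j < m
      j<m = +-cancelˡ-≤ m (suc j) m (≤-trans (≤-reflexive (+-suc m j))
        (≤-trans (*-cancelʳ-≤ f n 2 (≤-trans (≤-reflexive (sym g≡2f)) g≤2n))
          (≤-reflexive (sym m+m≡n))))

    oddCase : ∀ f → g ≡ suc (f * 2) → Unresolved (w ∷ w′ ∷ [])
    oddCase f g≡1+2f with <-≤-connex f m′
    -- The edge (n-1, n) starts at the even position 2(m+f) from `w′`, in the second half.
    ... | inj₁ f<m′ = edge₁ (suc (m′ * 2))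
      (≡-via (gap-odd m′) (gap-even m) gapᵒ[m′]≡gapᵉ[m])
      (subst (λ g → gap (suc (m′ * 2) + g) ≡ gap (m * 2 + g)) (sym g≡1+2f)
        (≡-via (odd+odd m′ f) (even+odd m f)
          (gapᵉ≡gapᵒ (≤-trans (+-monoʳ-< m (m≤n⇒m≤1+n f<m′)) (≤-reflexive m+m≡n))
            (≤-trans (≤-reflexive (sym m+m≡n)) (+-mono-≤ (m≤m+n m f) (m≤m+n m f))))))
    ... | inj₂ m′≤f with m≤n⇒m<n∨m≡n (*-cancelʳ-< 2 f n (≤-trans (≤-reflexive (sym g≡1+2f)) g≤2n))
    -- The edge (1, 2) starts at the even position 2(f+1) from `w′`, in the second half.
    ...   | inj₁ 1+f<n = edge₁ 1 gapᵒ[0]≡gapᵉ[1]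
      (subst (λ g → gap (1 + g) ≡ gap (2 + g)) (sym g≡1+2f)
        (≡-via (odd+odd 0 f) (even+odd 1 f)
          (gapᵉ≡gapᵒ 1+f<n (≤-trans (≤-reflexive (sym m+m≡n)) (+-mono-≤ (s≤s m′≤f) (s≤s m′≤f))))))
    -- Here `g` is 2n-1, so the edge (n, n+1) from `w` is the edge (n-1, n) from `w′`.
    ...   | inj₂ 1+f≡n = edge₁ (m * 2)
      (≡-via (gap-even m) (gap-odd m) gapᵉ[m]≡gapᵒ[m])
      (subst (λ g → gap (m * 2 + g) ≡ gap (suc (m * 2) + g)) (sym g≡1+2f)
        (≡-via (even+odd m f) (odd+odd m f) (begin
          gapᵒ (m + f)         ≡⟨ cong gapᵒ m+f≡m′+n ⟩
          gapᵒ (m′ + n)        ≡⟨ gapᵒ-periodic m′ ⟩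
          gapᵒ m′              ≡⟨ gapᵒ[m′]≡gapᵉ[m] ⟩
          gapᵉ m               ≡⟨ gapᵉ-periodic m ⟨
          gapᵉ (m + n)         ≡⟨ cong (gapᵉ ∘ suc) m+f≡m′+n ⟨
          gapᵉ (suc (m + f))   ∎)))
      where
      open ≡-Reasoning
      m+f≡m′+n : m + f ≡ m′ + n
      m+f≡m′+n = trans (sym (+-suc m′ f)) (cong (m′ +_) 1+f≡n)

    cases : ∀ {x} → Parityᵛ x → g ≡ x → Unresolved (w ∷ w′ ∷ [])
    cases (even f) = evenCase f
    cases (odd f)  = oddCase f

  unresolved-pair : ∀ m → m + m ≡ n → ∀ w w′ → Unresolved (w ∷ w′ ∷ [])
  unresolved-pair m m+m≡n w w′ with ≤-total (position w) (position w′)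
  ... | inj₁ q≤q′ = unresolved-ordered m m+m≡n w w′ q≤q′
  ... | inj₂ q′≤q with unresolved-ordered m m+m≡n w′ w q′≤q
  ...   | u , v , e , eq′ ∷ eq ∷ [] = u , v , e , eq ∷ eq′ ∷ []

  resolving⇒2≤length : ∀ W → LocalResolving G W → 2 ≤ length W
  resolving⇒2≤length []          r = contradiction r (unresolved⇒¬resolving unresolved-[])
  resolving⇒2≤length (w ∷ [])    r = contradiction r (unresolved⇒¬resolving (unresolved-singleton w))
  resolving⇒2≤length (_ ∷ _ ∷ _) r = s≤s (s≤s z≤n)

  even-resolving⇒3≤length : ∀ m → m + m ≡ n → ∀ W → LocalResolving G W → 3 ≤ length W
  even-resolving⇒3≤length m m+m≡n []              r = contradiction r (unresolved⇒¬resolving unresolved-[])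
  even-resolving⇒3≤length m m+m≡n (w ∷ [])        r = contradiction r (unresolved⇒¬resolving (unresolved-singleton w))
  even-resolving⇒3≤length m m+m≡n (w ∷ w′ ∷ [])   r = contradiction r (unresolved⇒¬resolving (unresolved-pair m m+m≡n w w′))
  even-resolving⇒3≤length m m+m≡n (_ ∷ _ ∷ _ ∷ _) r = s≤s (s≤s (s≤s z≤n))

  -- i - m ≡ j modulo n
  Offset : ℕ → ℕ → ℕ → Set
  Offset m i j = i + (n ∸ m) ≡ j ⊎ i + (n ∸ m) ≡ j + n

  offset-periodic : ∀ {f : ℕ → A} → Periodic n f → ∀ {m i j} → Offset m i j → f (i + (n ∸ m)) ≡ f j
  offset-periodic {f = f} per         (inj₁ eq) = cong f eq
  offset-periodic {f = f} per {j = j} (inj₂ eq) = trans (cong f eq) (per j)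

  offset-0 : ∀ i → Offset 0 i i
  offset-0 i = inj₂ refl

  offset-+ : ∀ {m} → m < n → ∀ j → Offset m (m + j) j
  offset-+ {m} m<n j = inj₂ (begin
    m + j + (n ∸ m)     ≡⟨ cong (_+ (n ∸ m)) (+-comm m j) ⟩
    j + m + (n ∸ m)     ≡⟨ +-assoc j m (n ∸ m) ⟩
    j + (m + (n ∸ m))   ≡⟨ cong (j +_) (m+[n∸m]≡n (<⇒≤ m<n)) ⟩
    j + n               ∎)
    where open ≡-Reasoning

  -- Upper bounds: edges resolved by a-vertices.

  aₖ-position : ∀ {m} → m < n → position (aₖ m) ≡ m * 2
  aₖ-position {m} m<n = cong (_* 2) (trans (toℕ-mod m) (m<n⇒m%n≡m m<n))

  aₖ-≢ : ∀ {k l} → k < n → l < n → k ≢ l → aₖ k ≢ aₖ l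
  aₖ-≢ {k} {l} k<n l<n k≢l eq = k≢l (*-cancelʳ-≡ k l 2
    (trans (sym (aₖ-position k<n)) (trans (cong position eq) (aₖ-position l<n))))

  module _ {m} (m<n : m < n) where

    private
      s = n * 2 ∸ position (aₖ m)

      s≡ : s ≡ (n ∸ m) * 2
      s≡ = trans (cong (n * 2 ∸_) (aₖ-position m<n)) (sym (*-distribʳ-∸ 2 n m))

    -- A landmark in row a has an even position, so parities survive the subtraction and only the
    -- offset of the index matters.
    gap-from-a-even : ∀ {k j} → Offset m k j → gap (k * 2 + s) ≡ gapᵉ j
    gap-from-a-even {k} {j} o = begin
      gap (k * 2 + s)             ≡⟨ cong (λ x → gap (k * 2 + x)) s≡ ⟩
      gap (k * 2 + (n ∸ m) * 2)   ≡⟨ cong gap (*-distribʳ-+ 2 k (n ∸ m)) ⟨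
      gap ((k + (n ∸ m)) * 2)     ≡⟨ gap-even (k + (n ∸ m)) ⟩
      gapᵉ (k + (n ∸ m))          ≡⟨ offset-periodic gapᵉ-periodic {m} {k} o ⟩
      gapᵉ j                      ∎
      where open ≡-Reasoning

    gap-from-a-odd : ∀ {k j} → Offset m k j → gap (suc (k * 2) + s) ≡ gapᵒ j
    gap-from-a-odd {k} {j} o = begin
      gap (suc (k * 2 + s))             ≡⟨ cong (λ x → gap (suc (k * 2 + x))) s≡ ⟩
      gap (suc (k * 2 + (n ∸ m) * 2))   ≡⟨ cong (gap ∘ suc) (*-distribʳ-+ 2 k (n ∸ m)) ⟨
      gap (suc ((k + (n ∸ m)) * 2))     ≡⟨ gap-odd (k + (n ∸ m)) ⟩
      gapᵒ (k + (n ∸ m))                ≡⟨ offset-periodic gapᵒ-periodic {m} {k} o ⟩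
      gapᵒ j                            ∎
      where open ≡-Reasoning

    offset-suc : ∀ {i j} → Offset m i j → Offset m (suc i) (suc j)
    offset-suc (inj₁ eq) = inj₁ (cong suc eq)
    offset-suc (inj₂ eq) = inj₂ (cong suc eq)

    module _ {i : Fin n} {j} (o : Offset m (toℕ i) j) where

      resolves-ab : gapᵉ j ≢ gapᵒ j → dist (aₖ m) (a i) ≢ dist (aₖ m) (b i)
      resolves-ab = +-≢ 0 (gap-from-a-even o) (gap-from-a-odd o)

      resolves-a⁺b : gapᵒ j ≢ gapᵉ (suc j) → dist (aₖ m) (a (next i)) ≢ dist (aₖ m) (b i)
      resolves-a⁺b ≢ = +-≢ 0
        (trans (gap-mod (suc (toℕ i)) s) (gap-from-a-even (offset-suc o))) (gap-from-a-odd o) (≢-sym ≢)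

      resolves-aa : gapᵉ j ≢ gapᵉ (suc j) → dist (aₖ m) (a i) ≢ dist (aₖ m) (a (next i))
      resolves-aa = +-≢ 0 (gap-from-a-even o)
        (trans (gap-mod (suc (toℕ i)) s) (gap-from-a-even (offset-suc o)))

      -- Serves rows b, c and d at once, with `l` = 0, 1, 2.
      resolves-odd : ∀ l → gapᵒ j ≢ gapᵒ (suc j) →
        gap (suc (toℕ i * 2) + s) + l ≢ gap (suc (toℕ (next i) * 2) + s) + l
      resolves-odd l = +-≢ l (gap-from-a-odd o)
        (trans (gap-mod-suc (suc (toℕ i)) s) (gap-from-a-odd (offset-suc o)))

  Sees : List Vertex → (ℕ → Set) → Set
  Sees W P = ∀ i → i < n → ∃[ m ] ∃[ j ] (aₖ m ∈ W × m < n × Offset m i j × P j)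

  -- The rim and the three odd rows reduce to four conditions on offsets. On the vertical edges the
  -- gaps agree and the levels differ, so `aₖ 0` resolves them all.
  sees⇒resolving : ∀ {W} → aₖ 0 ∈ W →
    Sees W (λ j → gapᵉ j ≢ gapᵒ j) → Sees W (λ j → gapᵒ j ≢ gapᵉ (suc j)) →
    Sees W (λ j → gapᵉ j ≢ gapᵉ (suc j)) → Sees W (λ j → gapᵒ j ≢ gapᵒ (suc j)) →
    LocalResolving G W
  sees⇒resolving {W} a₀∈W eo oe ee oo _ _ = λ
    { (fwd e) → let w , w∈W , ≢ = go e in w , w∈W , resolves ≢
    ; (bwd e) → let w , w∈W , ≢ = go e in w , w∈W , resolves (≢-sym ≢) }
    where
    go : ∀ {u v} → SEdge u v → ∃[ w ] (w ∈ W × dist w u ≢ dist w v)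
    go (aa i)  = let m , j , ∈W , m<n , o , ≢ = ee (toℕ i) (toℕ<n i) in aₖ m , ∈W , resolves-aa m<n o ≢
    go (bb i)  = let m , j , ∈W , m<n , o , ≢ = oo (toℕ i) (toℕ<n i) in aₖ m , ∈W , resolves-odd m<n o 0 ≢
    go (cc i)  = let m , j , ∈W , m<n , o , ≢ = oo (toℕ i) (toℕ<n i) in aₖ m , ∈W , resolves-odd m<n o 1 ≢
    go (dd i)  = let m , j , ∈W , m<n , o , ≢ = oo (toℕ i) (toℕ<n i) in aₖ m , ∈W , resolves-odd m<n o 2 ≢
    go (a⁺b i) = let m , j , ∈W , m<n , o , ≢ = oe (toℕ i) (toℕ<n i) in aₖ m , ∈W , resolves-a⁺b m<n o ≢
    go (ab i)  = let m , j , ∈W , m<n , o , ≢ = eo (toℕ i) (toℕ<n i) in aₖ m , ∈W , resolves-ab m<n o ≢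
    go (bc i)  = aₖ 0 , a₀∈W , λ eq → contradiction (+-cancelˡ-≡ (gap (suc (toℕ i * 2) + _)) 0 1 eq) λ ()
    go (cd i)  = aₖ 0 , a₀∈W , λ eq → contradiction (+-cancelˡ-≡ (gap (suc (toℕ i * 2) + _)) 1 2 eq) λ ()

  0<n : 0 < n
  0<n = <-trans z<s 3≤n

  1<n : 1 < n
  1<n = ≤-trans (n≤1+n 2) 3≤n

  -- m = ⌈n/2⌉
  module Halves (m : ℕ) (n≤2m : n ≤ m + m) (2m≤1+n : m + m ≤ suc n) where

    m<n : m < n
    m<n = ≰⇒> λ n≤m → <⇒≱ 1<n (+-cancelˡ-≤ n n 1
      (≤-trans (+-mono-≤ n≤m n≤m) (≤-trans 2m≤1+n (≤-reflexive (+-comm 1 n)))))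

    module _ {W} (a₀∈W : aₖ 0 ∈ W) (aₘ∈W : aₖ m ∈ W) where

      -- `aₖ 0` handles the first half; every later index is `m + j`, and offset `j` is in the first
      -- half as seen from `aₖ m`.
      sees-ab : Sees W (λ j → gapᵉ j ≢ gapᵒ j)
      sees-ab i i<n with <-≤-connex (i + i) n
      ... | inj₁ 2i<n = 0 , i , a₀∈W , 0<n , offset-0 i , gapᵉ≢gapᵒ 2i<n
      ... | inj₂ n≤2i with m≤n⇒∃[o]m+o≡n {m} {i} (double-cancel-≤ (≤-trans 2m≤1+n (s≤s n≤2i)))
      ...   | j , refl = m , j , aₘ∈W , m<n , offset-+ m<n j , gapᵉ≢gapᵒ 2j<n
        where
        lemma : ∀ m j → m + j + (m + j) ≡ m + m + (j + j)
        lemma = solve-∀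

        2j<n : j + j < n
        2j<n = +-cancelˡ-< (m + m) (j + j) n (begin-strict
          m + m + (j + j)   ≡⟨ lemma m j ⟨
          m + j + (m + j)   <⟨ +-mono-< i<n i<n ⟩
          n + n             ≤⟨ +-monoˡ-≤ n n≤2m ⟩
          m + m + n         ∎)
          where open ≤-Reasoning

      -- Dually, `aₖ 0` handles the second half, and an earlier index has offset `i + (n ∸ m)` from
      -- `aₖ m`, which is in the second half without wrapping around.
      sees-a⁺b : Sees W (λ j → gapᵒ j ≢ gapᵉ (suc j))
      sees-a⁺b i i<n with ≤-<-connex n (suc (i + i))
      ... | inj₁ n≤1+2i = 0 , i , a₀∈W , 0<n , offset-0 i , gapᵒ≢gapᵉ i<n n≤1+2i
      ... | inj₂ 1+2i<n = m , i + t , aₘ∈W , m<n , inj₁ refl , gapᵒ≢gapᵉ j<n n≤1+2j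
        where
        open ≤-Reasoning
        t = n ∸ m

        m+t≡n : m + t ≡ n
        m+t≡n = m+[n∸m]≡n (<⇒≤ m<n)

        i<m : i < m
        i<m = double-cancel-≤ (begin
          suc i + suc i    ≡⟨ cong suc (+-suc i i) ⟩
          2 + (i + i)      ≤⟨ 1+2i<n ⟩
          n                ≤⟨ n≤2m ⟩
          m + m            ≤⟨ n≤1+n _ ⟩
          suc (m + m)      ∎)

        j<n : i + t < n
        j<n = <-≤-trans (+-monoˡ-< t i<m) (≤-reflexive m+t≡n)

        lemma : ∀ m t → m + t + (m + t) ≡ m + m + (t + t)
        lemma = solve-∀

        n≤1+2t : n ≤ suc (t + t)
        n≤1+2t = +-cancelˡ-≤ n n (suc (t + t)) (begin
          n + n               ≡⟨ cong₂ _+_ m+t≡n m+t≡n ⟨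
          m + t + (m + t)     ≡⟨ lemma m t ⟩
          m + m + (t + t)     ≤⟨ +-monoˡ-≤ (t + t) 2m≤1+n ⟩
          suc n + (t + t)     ≡⟨ +-suc n (t + t) ⟨
          n + suc (t + t)     ∎)

        n≤1+2j : n ≤ suc (i + t + (i + t))
        n≤1+2j = ≤-trans n≤1+2t (s≤s (+-mono-≤ (m≤n+m t i) (m≤n+m t i)))

  -- A resolving pair for odd `n`.

  module OddCycle (m : ℕ) (2m≡1+n : m + m ≡ suc n) where
    open Halves m (≤-trans (n≤1+n n) (≤-reflexive (sym 2m≡1+n))) (≤-reflexive 2m≡1+n)

    odd-basis : List Vertex
    odd-basis = aₖ 0 ∷ aₖ m ∷ []

    even≢n : ∀ k → k + k ≢ n
    even≢n k 2k≡n = double≢suc-double m k (trans 2m≡1+n (cong suc (sym 2k≡n)))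

    -- The one edge that `aₖ 0` misses ends at `aₖ m`: its offset there is `n - 1`, which would be
    -- exceptional only for n = 1.
    sees-aa : Sees odd-basis (λ j → gapᵉ j ≢ gapᵉ (suc j))
    sees-aa i i<n with suc (i + i) ≟ n
    ... | no 1+2i≢n  = 0 , i , here refl , 0<n , offset-0 i , gapᵉ≢gapᵉ i<n 1+2i≢n
    ... | yes 1+2i≡n = m , j , there (here refl) , m<n , inj₁ refl ,
      gapᵉ≢gapᵉ (≤-reflexive 1+j≡n) λ 1+2j≡n → <⇒≢ 1<n (trans (cong suc (sym (j≡0 1+2j≡n))) 1+j≡n)
      where
      j = i + (n ∸ m)

      m≡1+i : m ≡ suc i
      m≡1+i = double-cancel-≡ (trans 2m≡1+n (cong suc (trans (sym 1+2i≡n) (sym (+-suc i i)))))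

      1+j≡n : suc j ≡ n
      1+j≡n = trans (cong (_+ (n ∸ m)) (sym m≡1+i)) (m+[n∸m]≡n (<⇒≤ m<n))

      j≡0 : suc (j + j) ≡ n → j ≡ 0
      j≡0 1+2j≡n = +-cancelˡ-≡ j j 0
        (trans (suc-injective (trans 1+2j≡n (sym 1+j≡n))) (sym (+-identityʳ j)))

    0<m : 0 < m
    0<m = n≢0⇒n>0 λ { refl → contradiction 2m≡1+n λ () }

    -- By parity no such edge is centred opposite to a landmark; `aₖ 0` misses only the edge centred
    -- at itself, which `aₖ m` sees.
    sees-bb : Sees odd-basis (λ j → gapᵒ j ≢ gapᵒ (suc j))
    sees-bb i i<n with m≤n⇒m<n∨m≡n i<n
    ... | inj₁ 1+i<n = 0 , i , here refl , 0<n , offset-0 i , gapᵒ≢gapᵒ 1+i<n (even≢n (suc i))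
    ... | inj₂ 1+i≡n with m≤n⇒∃[o]m+o≡n {m} {i} (≤-pred (≤-trans m<n (≤-reflexive (sym 1+i≡n))))
    ...   | j , refl = m , j , there (here refl) , m<n , offset-+ m<n j ,
      gapᵒ≢gapᵒ (≤-trans (s≤s (m<n+m j 0<m)) i<n) (even≢n (suc j))

    odd-basis-resolving : LocalResolving G odd-basis
    odd-basis-resolving = sees⇒resolving a₀∈W (sees-ab a₀∈W aₘ∈W) (sees-a⁺b a₀∈W aₘ∈W) sees-aa sees-bb
      where
      a₀∈W = here refl
      aₘ∈W = there (here refl)

    odd-lmd : LocalMetricDimension G 2
    odd-lmd = (odd-basis , (aₖ-≢ 0<n m<n (<⇒≢ 0<m) ∷ []) ∷ [] ∷ [] , odd-basis-resolving , refl)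
            , λ { _ (W , _ , r , refl) → resolving⇒2≤length W r }

  -- A resolving triple for even `n`.

  module EvenCycle (m : ℕ) (2m≡n : m + m ≡ n) where
    open Halves m (≤-reflexive (sym 2m≡n)) (≤-trans (≤-reflexive 2m≡n) (n≤1+n n))

    -- `aₖ 0` and `aₖ m` are antipodal and miss the same edges in rows b, c and d; `aₖ 1` is added
    -- for those.
    even-basis : List Vertex
    even-basis = aₖ 0 ∷ aₖ m ∷ aₖ 1 ∷ []

    1<m : 1 < m
    1<m = double-cancel-≤ {2} (≤-trans (s≤s 3≤n) (s≤s (≤-reflexive (sym 2m≡n))))

    sees-aa : Sees even-basis (λ j → gapᵉ j ≢ gapᵉ (suc j))
    sees-aa i i<n = 0 , i , here refl , 0<n , offset-0 i ,
      gapᵉ≢gapᵉ i<n λ 1+2i≡n → double≢suc-double m i (trans 2m≡n (sym 1+2i≡n))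

    -- a₀ fails only at i = n-1 and i = m-1, where a₁ succeeds.
    sees-bb : Sees even-basis (λ j → gapᵒ j ≢ gapᵒ (suc j))
    sees-bb i i<n with suc i ≟ n | suc i + suc i ≟ n
    ... | no 1+i≢n | no 2+2i≢n = 0 , i , here refl , 0<n , offset-0 i , gapᵒ≢gapᵒ (≤∧≢⇒< i<n 1+i≢n) 2+2i≢n
    sees-bb zero    i<n | yes 1≡n | _ = contradiction 1≡n (<⇒≢ 1<n)
    sees-bb zero    i<n | _ | yes 2≡n = contradiction 2≡n (<⇒≢ 3≤n)
    -- The offset from `aₖ 1` is n-2, exceptional only for n = 2.
    sees-bb (suc j) i<n | yes 1+i≡n | _ = 1 , j , there (there (here refl)) , 1<n , offset-+ 1<n j ,
      gapᵒ≢gapᵒ i<n λ 2i≡n → <⇒≢ 3≤n (trans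
        (cong suc (sym (+-cancelˡ-≡ (suc j) (suc j) 1 (trans 2i≡n (trans (sym 1+i≡n) (+-comm 1 (suc j)))))))
        1+i≡n)
    -- The offset from `aₖ 1` is m-2, one short of the exceptional m-1.
    sees-bb (suc j) i<n | no _ | yes 2+2i≡n = 1 , j , there (there (here refl)) , 1<n , offset-+ 1<n j ,
      gapᵒ≢gapᵒ i<n λ 2i≡n → <⇒≢ (+-mono-< (n<1+n (suc j)) (n<1+n (suc j))) (trans 2i≡n (sym 2+2i≡n))

    even-basis-resolving : LocalResolving G even-basis
    even-basis-resolving = sees⇒resolving a₀∈W (sees-ab a₀∈W aₘ∈W) (sees-a⁺b a₀∈W aₘ∈W) sees-aa sees-bb
      where
      a₀∈W = here refl
      aₘ∈W = there (here refl)

    even-lmd : LocalMetricDimension G 3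
    even-lmd = (even-basis , unique , even-basis-resolving , refl)
             , λ { _ (W , _ , r , refl) → even-resolving⇒3≤length m 2m≡n W r }
      where
      unique = (aₖ-≢ 0<n m<n (<⇒≢ (<⇒≤ 1<m)) ∷ aₖ-≢ 0<n 1<n (λ ()) ∷ [])
             ∷ (aₖ-≢ m<n 1<n (≢-sym (<⇒≢ 1<m)) ∷ [])
             ∷ [] ∷ []

theorem3p1 : (n : ℕ) (3≤n : 3 ≤ n) →
    (2 ∤ n → LocalMetricDimension (S n 3≤n) 2) ×
    (2 ∣ n → LocalMetricDimension (S n 3≤n) 3)
theorem3p1 n 3≤n = odd-n (parityᵛ n) refl , even-n
  where
  open Polytope n 3≤n

  k*2≡k+k : ∀ k → k * 2 ≡ k + k
  k*2≡k+k = solve-∀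

  odd-n : ∀ {x} → Parityᵛ x → n ≡ x → 2 ∤ n → LocalMetricDimension (S n 3≤n) 2
  odd-n (even k) n≡2k   2∤n = contradiction (divides k n≡2k) 2∤n
  -- For n = 2k+1 the rounded-up half is k+1.
  odd-n (odd k)  n≡1+2k _   = OddCycle.odd-lmd (suc k)
    (trans (sym (k*2≡k+k (suc k))) (cong suc (sym n≡1+2k)))

  even-n : 2 ∣ n → LocalMetricDimension (S n 3≤n) 3
  even-n (divides k n≡2k) = EvenCycle.even-lmd k (trans (sym (k*2≡k+k k)) (sym n≡2k))
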